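{- For all integers $n\ge 2$ and $1\le\alpha\le k\le n$ there exists a sequence of queries $Q_1,\dots,Q_t\subseteq N=\{1,\dots,n\}$ of length $$t=O\left(\min\left\{n,\ \left(k + \frac{n}{\alpha} \right)\log n\right\}\right)$$ that solves Group Testing for hidden sets of size at most $k$ under the feedback $F_\alpha(X)=\min\{|X|,\alpha\}$. The constant hidden in $O(\cdot)$ is absolute.
   Context: Let $N=\{1,\dots,n\}$. For $\alpha\in\{1,\dots,k\}$, the $\alpha$-capped quantitative feedback is $F_\alpha(X)=\min\{|X|,\alpha\}$ for $X\subseteq N$. A fixed (non-adaptive) sequence of queries $Q_1,\dots,Q_t\subseteq N$ solves Group Testing (for parameter $k$) under feedback $F_\alpha$ if for any two different sets $K_1,K_2\subseteq N$ with $|K_1|,|K_2|\le k$ the feedback vectors $\langle F_\alpha(Q_1\cap K_1),\dots,F_\alpha(Q_t\cap K_1)\rangle$ and $\langle F_\alpha(Q_1\cap K_2),\dots,F_\alpha(Q_t\cap K_2)\rangle$ are different. -}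

module Defs where

open import Data.Nat.Base as ℕ using (ℕ; NonZero)
open import Data.Nat.Logarithm using (⌊log₂_⌋)
open import Data.Integer.Base using (+_)
open import Data.Rational.Unnormalised.Base using (ℚᵘ; _/_; _+_; _*_; _⊓_)
open import Data.Fin.Subset using (Subset; _∩_; ∣_∣)
open import Data.Vec.Base using (Vec; map)
open import Relation.Binary.PropositionalEquality using (_≢_)

cappedFeedback : ∀ {n} → ℕ → Subset n → ℕ
cappedFeedback α X = ∣ X ∣ ℕ.⊓ α

feedbackVector : ∀ {n t} → ℕ → Vec (Subset n) t → Subset n → Vec ℕ t
feedbackVector α Qs K = map (λ Q → cappedFeedback α (Q ∩ K)) Qs

SolvesGroupTesting : ∀ {n t} → (k α : ℕ) → Vec (Subset n) t → Set
SolvesGroupTesting {n} k α Qs =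
  (K₁ K₂ : Subset n) → ∣ K₁ ∣ ℕ.≤ k → ∣ K₂ ∣ ℕ.≤ k →
  K₁ ≢ K₂ → feedbackVector α Qs K₁ ≢ feedbackVector α Qs K₂

fromℕ : ℕ → ℚᵘ
fromℕ m = + m / 1

-- The division n / α is exact, in the rationals.  The logarithm is rounded
-- down to an integer: for n ≥ 2, ⌊log₂ n⌋ ≤ log₂ n ≤ 2 ⌊log₂ n⌋, so under an
-- absolute constant factor this is the same as the real logarithm in any
-- fixed base.
queryBound : (n k α : ℕ) .{{_ : NonZero α}} → ℚᵘ
queryBound n k α =
  fromℕ n ⊓ ((fromℕ k + (+ n / α)) * fromℕ ⌊log₂ n ⌋)

{-# OPTIONS --safe #-}

-- A query Q with ∣ Q ∣ ≤ α is never capped, so it separates K₁ from K₂ as soon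
-- as the sign vector v = 1_{K₁} − 1_{K₂} has a nonzero sum over Q.  Take
-- Q = {x₁, …, x_α} ∩ R with uniform xᵢ ∈ N and uniform R ⊆ N.  If v has support
-- of size d, the xᵢ miss it with probability (1 − d/n)^α ≤ n / (n + dα), and
-- otherwise R makes the sum nonzero with probability at least 1/2.  Hence Q
-- fails on v with probability at most (2n + dα) / (2n + 2dα), and
-- (2n/α + 2d) ⌈log₂ 4n⌉ independent queries all fail with probability at most
-- (4n)^{−d}.  Unlike the pairs (K₁ , K₂), the vectors v of support d number
-- only (n choose d) 2^d, so a union bound over v suffices.  When n is the
-- smaller term of the minimum, the n singletons are used instead.

module Submission where

open import Data.Nat.Base
  using (ℕ; zero; suc; NonZero; >-nonZero; >-nonZero⁻¹; _≤_; _<_; z≤n; s≤s;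
         _+_; _*_; _^_; _/_; _%_; _⊓_)
open import Data.Nat.Properties
open import Data.Nat.DivMod using (m/n*n≤m; m≡m%n+[m/n]*n; m%n<n; /-monoˡ-≤; m*n/n≡m; +-distrib-/-∣ʳ)
open import Data.Nat.Divisibility using (n∣m*n)
open import Data.Nat.Logarithm using (⌊log₂_⌋; ⌊log₂⌋-mono-≤; ⌊log₂[2^n]⌋≡n)
open import Data.Nat.ListAction using (sum)
open import Data.Nat.ListAction.Properties using (sum-++)
open import Data.Nat.Tactic.RingSolver using (solve-∀)
import Data.Integer.Base as ℤ
import Data.Integer.Properties as ℤ
open import Data.Rational.Unnormalised.Base as ℚᵘ using (ℚᵘ)
import Data.Rational.Unnormalised.Properties as ℚᵘ
open import Data.Bool.Properties using (∨-zeroʳ)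
open import Data.Bool.Base using (Bool; true; false; _∧_; _∨_)
open import Data.Fin.Base using (Fin; zero; suc)
open import Data.Fin.Subset using (Subset; _∩_; _∪_; ∣_∣; ⁅_⁆; ⊥)
open import Data.Fin.Subset.Properties using (∣p∩q∣≤∣p∣; ∣⁅x⁆∣≡1; ∣⊥∣≡0; ∩-zeroˡ)
open import Data.List.Base as List using (List; []; _∷_; cartesianProductWith; allFin)
import Data.List.Properties as List
open import Data.List.Membership.Propositional using (_∈_)
open import Data.List.Membership.Propositional.Properties using (∈-cartesianProductWith⁺)
open import Data.List.Relation.Unary.Any using (here; there)
open import Data.Vec.Base as Vec using (Vec; []; _∷_; lookup)
import Data.Vec.Properties as Vec
open import Data.Product.Base using (Σ-syntax; ∃-syntax; _×_; _,_)
open import Data.Sum.Base using (_⊎_; inj₁; inj₂)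
open import Function.Base using (_∘_; id; const)
open import Relation.Nullary using (yes; no; contradiction)
open import Relation.Binary.PropositionalEquality
  using (_≡_; _≢_; refl; sym; trans; cong; cong₂; subst; subst₂; _≗_; module ≡-Reasoning)
open import Defs

private
  variable
    A B D : Set
    n : ℕ

-- Sums over finite lists.

∑ : List A → (A → ℕ) → ℕ
∑ xs f = sum (List.map f xs)

∑-cong : (xs : List A) {f g : A → ℕ} → f ≗ g → ∑ xs f ≡ ∑ xs g
∑-cong xs f≗g = cong sum (List.map-cong f≗g xs)

∑-mono : (xs : List A) {f g : A → ℕ} → (∀ x → f x ≤ g x) → ∑ xs f ≤ ∑ xs g
∑-mono []       f≤g = z≤n
∑-mono (x ∷ xs) f≤g = +-mono-≤ (f≤g x) (∑-mono xs f≤g)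

∑-distrib-+ : (xs : List A) (f g : A → ℕ) →
              ∑ xs (λ x → f x + g x) ≡ ∑ xs f + ∑ xs g
∑-distrib-+ []       f g = refl
∑-distrib-+ (x ∷ xs) f g rewrite ∑-distrib-+ xs f g =
  interchange (f x) (g x) (∑ xs f) (∑ xs g)
  where
  interchange : ∀ a b c d → a + b + (c + d) ≡ a + c + (b + d)
  interchange = solve-∀

*-distribˡ-∑ : (xs : List A) (c : ℕ) (f : A → ℕ) →
               c * ∑ xs f ≡ ∑ xs (λ x → c * f x)
*-distribˡ-∑ []       c f = *-zeroʳ c
*-distribˡ-∑ (x ∷ xs) c f =
  trans (*-distribˡ-+ c (f x) (∑ xs f)) (cong (c * f x +_) (*-distribˡ-∑ xs c f))

*-distribʳ-∑ : (xs : List A) (c : ℕ) (f : A → ℕ) →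
               ∑ xs f * c ≡ ∑ xs (λ x → f x * c)
*-distribʳ-∑ xs c f =
  trans (*-comm (∑ xs f) c)
    (trans (*-distribˡ-∑ xs c f) (∑-cong xs (λ x → *-comm c (f x))))

∑-zero : (xs : List A) → ∑ xs (const 0) ≡ 0
∑-zero []       = refl
∑-zero (x ∷ xs) = ∑-zero xs

∑-comm : (xs : List A) (ys : List B) (f : A → B → ℕ) →
         ∑ xs (λ x → ∑ ys (f x)) ≡ ∑ ys (λ y → ∑ xs (λ x → f x y))
∑-comm []       ys f = sym (∑-zero ys)
∑-comm (x ∷ xs) ys f =
  trans (cong (∑ ys (f x) +_) (∑-comm xs ys f))
    (sym (∑-distrib-+ ys (f x) (λ y → ∑ xs (λ x′ → f x′ y))))

∑-cartesianProductWith : (g : A → B → D) (xs : List A) (ys : List B) (f : D → ℕ) →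
  ∑ (cartesianProductWith g xs ys) f ≡ ∑ xs (λ x → ∑ ys (λ y → f (g x y)))
∑-cartesianProductWith g []       ys f = refl
∑-cartesianProductWith g (x ∷ xs) ys f = begin
  sum (List.map f (List.map (g x) ys List.++ rest))
    ≡⟨ cong sum (List.map-++ f (List.map (g x) ys) rest) ⟩
  sum (List.map f (List.map (g x) ys) List.++ List.map f rest)
    ≡⟨ sum-++ (List.map f (List.map (g x) ys)) (List.map f rest) ⟩
  sum (List.map f (List.map (g x) ys)) + ∑ rest f
    ≡⟨ cong₂ _+_ (cong sum (sym (List.map-∘ ys))) (∑-cartesianProductWith g xs ys f) ⟩
  ∑ ys (λ y → f (g x y)) + ∑ xs (λ x′ → ∑ ys (λ y → f (g x′ y))) ∎
  where
  open ≡-Reasoning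
  rest = cartesianProductWith g xs ys

∑≡0⇒≡0 : {xs : List A} (f : A → ℕ) {x : A} → ∑ xs f ≡ 0 → x ∈ xs → f x ≡ 0
∑≡0⇒≡0 {xs = y ∷ ys} f eq (here refl)  = m+n≡0⇒m≡0 (f y) eq
∑≡0⇒≡0 {xs = y ∷ ys} f eq (there x∈ys) = ∑≡0⇒≡0 f (m+n≡0⇒n≡0 (f y) eq) x∈ys

∑-allFin-lookup : (f : A → ℕ) (v : Vec A n) →
                  ∑ (allFin n) (f ∘ lookup v) ≡ Vec.sum (Vec.map f v)
∑-allFin-lookup f v =
  trans (cong sum (List.map-tabulate id (f ∘ lookup v))) (go f v)
  where
  go : ∀ {n} (f : A → ℕ) (v : Vec A n) → sum (List.tabulate (f ∘ lookup v)) ≡ Vec.sum (Vec.map f v)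
  go f []      = refl
  go f (x ∷ v) = cong (f x +_) (go f v)

-- Products and independent draws.

∏ : Vec A n → (A → ℕ) → ℕ
∏ v f = Vec.foldr′ (λ x p → f x * p) 1 v

-- A list acts as a uniform probability space: `∑ xs f` over `∑ xs (const 1)` is an expectation, so
-- only counts occur. `vectors xs n` is the space of `n` independent draws.
vectors : List A → ∀ n → List (Vec A n)
vectors xs zero    = [] ∷ []
vectors xs (suc n) = cartesianProductWith _∷_ xs (vectors xs n)

∈-vectors : {xs : List A} → (∀ x → x ∈ xs) → (v : Vec A n) → v ∈ vectors xs n
∈-vectors all []      = here refl
∈-vectors all (x ∷ v) = ∈-cartesianProductWith⁺ _∷_ (all x) (∈-vectors all v)

-- Distributivity expands the power. This serves as independence of draws and, over `signs`, as a
-- generating function for sign vectors.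
∑-vectors-∏ : (xs : List A) (f : A → ℕ) (n : ℕ) →
              ∑ (vectors xs n) (λ v → ∏ v f) ≡ ∑ xs f ^ n
∑-vectors-∏ xs f zero    = refl
∑-vectors-∏ xs f (suc n) = begin
  ∑ (vectors xs (suc n)) (λ v → ∏ v f)
    ≡⟨ ∑-cartesianProductWith _∷_ xs (vectors xs n) (λ v → ∏ v f) ⟩
  ∑ xs (λ x → ∑ (vectors xs n) (λ v → f x * ∏ v f))
    ≡⟨ ∑-cong xs (λ x → sym (*-distribˡ-∑ (vectors xs n) (f x) (λ v → ∏ v f))) ⟩
  ∑ xs (λ x → f x * ∑ (vectors xs n) (λ v → ∏ v f))
    ≡⟨ sym (*-distribʳ-∑ xs _ f) ⟩
  ∑ xs f * ∑ (vectors xs n) (λ v → ∏ v f)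
    ≡⟨ cong (∑ xs f *_) (∑-vectors-∏ xs f n) ⟩
  ∑ xs f * ∑ xs f ^ n ∎
  where open ≡-Reasoning

∏-const-1 : (v : Vec A n) → ∏ v (const 1) ≡ 1
∏-const-1 []      = refl
∏-const-1 (x ∷ v) = trans (+-identityʳ _) (∏-const-1 v)

∑-vectors-1 : (xs : List A) (n : ℕ) → ∑ (vectors xs n) (const 1) ≡ ∑ xs (const 1) ^ n
∑-vectors-1 xs n =
  trans (∑-cong (vectors xs n) (λ v → sym (∏-const-1 v))) (∑-vectors-∏ xs (const 1) n)

-- Choosing a sequence by averaging.

averaging : (xs : List A) (f : A → ℕ) {b : ℕ} →
            ∑ xs f < ∑ xs (const 1) * b → ∃[ x ] f x < b
averaging (x ∷ xs) f {b} lt with f x <? b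
... | yes fx<b = x , fx<b
... | no  fx≮b = averaging xs f
  (+-cancelˡ-< b _ _ (≤-<-trans (+-monoˡ-≤ (∑ xs f) (≮⇒≥ fx≮b)) lt))

-- Method of conditional expectations: w weighs the objects not yet excluded,
-- and t random tests are expected to leave less than one of them.
selection : (Ω : List A) (V : List B) (fail : A → B → ℕ) (t : ℕ) (w : B → ℕ) →
  ∑ V (λ v → w v * ∑ Ω (λ q → fail q v) ^ t) < ∑ Ω (const 1) ^ t →
  Σ[ qs ∈ Vec A t ] ∑ V (λ v → w v * ∏ qs (λ q → fail q v)) < 1
selection Ω V fail zero    w lt = [] , lt
selection Ω V fail (suc t) w lt =
  -- `expand` splits one factor off the power and exchanges the sums, so some first test `q` keeps
  -- the total below the bound for the remaining `t` tests.
  let q , lt′  = averaging Ω _ (subst (_< ∑ Ω (const 1) * ∑ Ω (const 1) ^ t) expand lt)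
      qs , lt″ = selection Ω V fail t (λ v → w v * fail q v) lt′
  in q ∷ qs , subst (_< 1) (∑-cong V (λ v → *-assoc (w v) (fail q v) _)) lt″
  where
  F : _ → ℕ
  F v = ∑ Ω (λ q → fail q v)
  open ≡-Reasoning
  expand : ∑ V (λ v → w v * (F v * F v ^ t))
         ≡ ∑ Ω (λ q → ∑ V (λ v → w v * fail q v * F v ^ t))
  expand = begin
    ∑ V (λ v → w v * (F v * F v ^ t))
      ≡⟨ ∑-cong V (λ v → trans (sym (*-assoc (w v) (F v) _))
           (trans (cong (_* F v ^ t) (*-distribˡ-∑ Ω (w v) _)) (*-distribʳ-∑ Ω _ _))) ⟩
    ∑ V (λ v → ∑ Ω (λ q → w v * fail q v * F v ^ t))
      ≡⟨ ∑-comm V Ω _ ⟩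
    ∑ Ω (λ q → ∑ V (λ v → w v * fail q v * F v ^ t)) ∎

-- Sign vectors and differences of sets.

data Sign : Set where
  pos null neg : Sign

signs : List Sign
signs = pos ∷ null ∷ neg ∷ []

∈-signs : ∀ s → s ∈ signs
∈-signs pos  = here refl
∈-signs null = there (here refl)
∈-signs neg  = there (there (here refl))

isNull notNull : Sign → ℕ
isNull null = 1
isNull _    = 0
notNull null = 0
notNull _    = 1

support : Vec Sign n → ℕ
support v = Vec.sum (Vec.map notNull v)

nulls : Vec Sign n → ℕ
nulls v = Vec.sum (Vec.map isNull v)

nulls+support : (v : Vec Sign n) → nulls v + support v ≡ n
nulls+support []         = refl
nulls+support (null ∷ v) = cong suc (nulls+support v)
nulls+support (pos ∷ v)  = trans (+-suc _ _) (cong suc (nulls+support v))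
nulls+support (neg ∷ v)  = trans (+-suc _ _) (cong suc (nulls+support v))

gain loss : Bool → Sign → ℕ
gain true pos = 1
gain _    _   = 0
loss true neg = 1
loss _    _   = 0

-- The sum of `v` over `Q` is `gains Q v` minus `losses Q v`. Keeping the two counts apart avoids
-- negative numbers.
gains losses : Subset n → Vec Sign n → ℕ
gains []      []      = 0
gains (x ∷ Q) (s ∷ v) = gain x s + gains Q v
losses []      []      = 0
losses (x ∷ Q) (s ∷ v) = loss x s + losses Q v

sign : Bool → Bool → Sign
sign true  false = pos
sign false true  = neg
sign _     _     = null

difference : Subset n → Subset n → Vec Sign n
difference = Vec.zipWith sign

-- Both sides count `Q ∩ (K₁ ∪ K₂)`: the losses are the part of `Q` in `K₂` alone, the gains the
-- part in `K₁` alone.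
difference-balance : (Q K₁ K₂ : Subset n) →
  ∣ Q ∩ K₁ ∣ + losses Q (difference K₁ K₂) ≡ ∣ Q ∩ K₂ ∣ + gains Q (difference K₁ K₂)
difference-balance []          []          []          = refl
difference-balance (false ∷ Q) (true ∷ K)  (true ∷ L)  = difference-balance Q K L
difference-balance (false ∷ Q) (true ∷ K)  (false ∷ L) = difference-balance Q K L
difference-balance (false ∷ Q) (false ∷ K) (true ∷ L)  = difference-balance Q K L
difference-balance (false ∷ Q) (false ∷ K) (false ∷ L) = difference-balance Q K L
difference-balance (true ∷ Q)  (true ∷ K)  (true ∷ L)  = cong suc (difference-balance Q K L)
difference-balance (true ∷ Q)  (true ∷ K)  (false ∷ L) =
  trans (cong suc (difference-balance Q K L)) (sym (+-suc _ _))
difference-balance (true ∷ Q)  (false ∷ K) (true ∷ L)  =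
  trans (+-suc _ _) (cong suc (difference-balance Q K L))
difference-balance (true ∷ Q)  (false ∷ K) (false ∷ L) = difference-balance Q K L

support-difference≤ : (K₁ K₂ : Subset n) → support (difference K₁ K₂) ≤ ∣ K₁ ∣ + ∣ K₂ ∣
support-difference≤ []          []          = z≤n
support-difference≤ (true ∷ K)  (true ∷ L)  =
  m≤n⇒m≤1+n (≤-trans (support-difference≤ K L) (+-monoʳ-≤ ∣ K ∣ (n≤1+n ∣ L ∣)))
support-difference≤ (true ∷ K)  (false ∷ L) = s≤s (support-difference≤ K L)
support-difference≤ (false ∷ K) (true ∷ L)  =
  ≤-trans (s≤s (support-difference≤ K L)) (≤-reflexive (sym (+-suc ∣ K ∣ ∣ L ∣)))
support-difference≤ (false ∷ K) (false ∷ L) = support-difference≤ K L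

support-difference≡0 : (K₁ K₂ : Subset n) → support (difference K₁ K₂) ≡ 0 → K₁ ≡ K₂
support-difference≡0 []          []          _  = refl
support-difference≡0 (true ∷ K)  (true ∷ L)  eq = cong (true ∷_) (support-difference≡0 K L eq)
support-difference≡0 (false ∷ K) (false ∷ L) eq = cong (false ∷_) (support-difference≡0 K L eq)

-- Zero sums over a random subset.

δ : ℕ → ℕ → ℕ
δ zero    zero    = 1
δ (suc m) (suc n) = δ m n
δ _       _       = 0

δ-refl : ∀ m → δ m m ≡ 1
δ-refl zero    = refl
δ-refl (suc m) = δ-refl m

δ≤1 : ∀ m n → δ m n ≤ 1
δ≤1 zero    zero    = ≤-refl
δ≤1 zero    (suc n) = z≤n
δ≤1 (suc m) zero    = z≤n
δ≤1 (suc m) (suc n) = δ≤1 m n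

δ-sucˡ : ∀ m n → δ (suc m) n + δ m n ≤ 1
δ-sucˡ zero    zero          = ≤-refl
δ-sucˡ zero    (suc zero)    = ≤-refl
δ-sucˡ zero    (suc (suc n)) = z≤n
δ-sucˡ (suc m) zero          = z≤n
δ-sucˡ (suc m) (suc n)       = δ-sucˡ m n

δ-sucʳ : ∀ m n → δ m (suc n) + δ m n ≤ 1
δ-sucʳ zero          zero    = ≤-refl
δ-sucʳ (suc zero)    zero    = ≤-refl
δ-sucʳ (suc (suc m)) zero    = z≤n
δ-sucʳ zero          (suc n) = z≤n
δ-sucʳ (suc m)       (suc n) = δ-sucʳ m n

-- When the sign is not null, membership raises exactly one argument of `δ` by one, and equality
-- cannot hold both before and after.
δ-flip : ∀ s → s ≢ null → ∀ a b g l →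
  δ (a + (gain true s + g)) (b + (loss true s + l)) +
  δ (a + (gain false s + g)) (b + (loss false s + l)) ≤ 1
δ-flip pos  _  a b g l rewrite +-suc a g = δ-sucˡ (a + g) (b + l)
δ-flip null s≢ a b g l = contradiction refl s≢
δ-flip neg  _  a b g l rewrite +-suc b l = δ-sucʳ (a + g) (b + l)

-- `δ` is the Kronecker delta, so this is 1 when `v` sums to zero over `Q`. As a number it can be
-- multiplied along a sequence of queries.
fail : Subset n → Vec Sign n → ℕ
fail Q v = δ (gains Q v) (losses Q v)

sides : List Bool
sides = true ∷ false ∷ []

-- Flipping the membership in R of an element of X where v does not vanish
-- changes the difference of gains and losses; the offsets a and b make the
-- induction work.
halving : (X : Subset n) (v : Vec Sign n) (i : Fin n) →
  lookup X i ≡ true → lookup v i ≢ null → ∀ a b →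
  2 * ∑ (vectors sides n) (λ R → δ (a + gains (X ∩ R) v) (b + losses (X ∩ R) v)) ≤ 2 ^ n
halving {suc n} (true ∷ X) (s ∷ v) zero refl s≢ a b = begin
  2 * ∑ (vectors sides (suc n)) Φ
    ≡⟨ cong (2 *_) (∑-cartesianProductWith _∷_ sides Rs Φ) ⟩
  2 * (∑ Rs (Φ ∘ (true ∷_)) + (∑ Rs (Φ ∘ (false ∷_)) + 0))
    ≡⟨ cong (λ z → 2 * (∑ Rs (Φ ∘ (true ∷_)) + z)) (+-identityʳ _) ⟩
  2 * (∑ Rs (Φ ∘ (true ∷_)) + ∑ Rs (Φ ∘ (false ∷_)))
    ≡⟨ cong (2 *_) (∑-distrib-+ Rs (Φ ∘ (true ∷_)) (Φ ∘ (false ∷_))) ⟨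
  2 * ∑ Rs (λ R → Φ (true ∷ R) + Φ (false ∷ R))
    ≤⟨ *-monoʳ-≤ 2 (∑-mono Rs (λ R → δ-flip s s≢ a b _ _)) ⟩
  2 * ∑ Rs (const 1)
    ≡⟨ cong (2 *_) (∑-vectors-1 sides n) ⟩
  2 * 2 ^ n ∎
  where
  open ≤-Reasoning
  Rs = vectors sides n
  Φ : Subset (suc n) → ℕ
  Φ R = δ (a + gains ((true ∷ X) ∩ R) (s ∷ v)) (b + losses ((true ∷ X) ∩ R) (s ∷ v))
halving {suc n} (x ∷ X) (s ∷ v) (suc i) i∈X v≢ a b = begin
  2 * ∑ (vectors sides (suc n)) Φ
    ≡⟨ cong (2 *_) (∑-cartesianProductWith _∷_ sides Rs Φ) ⟩
  2 * (∑ Rs (Φ ∘ (true ∷_)) + (∑ Rs (Φ ∘ (false ∷_)) + 0))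
    ≡⟨ *-distribˡ-+ 2 (∑ Rs (Φ ∘ (true ∷_))) _ ⟩
  2 * ∑ Rs (Φ ∘ (true ∷_)) + 2 * (∑ Rs (Φ ∘ (false ∷_)) + 0)
    ≤⟨ +-mono-≤ (part true) (subst (λ z → 2 * z ≤ 2 ^ n) (sym (+-identityʳ (∑ Rs (Φ ∘ (false ∷_))))) (part false)) ⟩
  2 ^ n + 2 ^ n
    ≡⟨ cong (2 ^ n +_) (+-identityʳ (2 ^ n)) ⟨
  2 * 2 ^ n ∎
  where
  open ≤-Reasoning
  Rs = vectors sides n
  Φ : Subset (suc n) → ℕ
  Φ R = δ (a + gains ((x ∷ X) ∩ R) (s ∷ v)) (b + losses ((x ∷ X) ∩ R) (s ∷ v))
  part : ∀ r → 2 * ∑ Rs (Φ ∘ (r ∷_)) ≤ 2 ^ n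
  part r = ≤-trans
    (≤-reflexive (cong (2 *_) (∑-cong Rs (λ R →
      cong₂ δ (sym (+-assoc a (gain (x ∧ r) s) _)) (sym (+-assoc b (loss (x ∧ r) s) _))))))
    (halving X v i i∈X v≢ (a + gain (x ∧ r) s) (b + loss (x ∧ r) s))

-- Random queries and their failure count.

span : ∀ {α} → Vec (Fin n) α → Subset n
span = Vec.foldr′ (λ x X → ⁅ x ⁆ ∪ X) ⊥

∣p∪q∣≤∣p∣+∣q∣ : (p q : Subset n) → ∣ p ∪ q ∣ ≤ ∣ p ∣ + ∣ q ∣
∣p∪q∣≤∣p∣+∣q∣ []          []          = z≤n
∣p∪q∣≤∣p∣+∣q∣ (true ∷ p)  (true ∷ q)  =
  s≤s (≤-trans (∣p∪q∣≤∣p∣+∣q∣ p q) (+-monoʳ-≤ ∣ p ∣ (n≤1+n ∣ q ∣)))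
∣p∪q∣≤∣p∣+∣q∣ (true ∷ p)  (false ∷ q) = s≤s (∣p∪q∣≤∣p∣+∣q∣ p q)
∣p∪q∣≤∣p∣+∣q∣ (false ∷ p) (true ∷ q)  =
  ≤-trans (s≤s (∣p∪q∣≤∣p∣+∣q∣ p q)) (≤-reflexive (sym (+-suc ∣ p ∣ ∣ q ∣)))
∣p∪q∣≤∣p∣+∣q∣ (false ∷ p) (false ∷ q) = ∣p∪q∣≤∣p∣+∣q∣ p q

∣span∣≤ : ∀ {α} (xs : Vec (Fin n) α) → ∣ span xs ∣ ≤ α
∣span∣≤ {n} [] = ≤-reflexive (∣⊥∣≡0 n)
∣span∣≤ (x ∷ xs) = ≤-trans (∣p∪q∣≤∣p∣+∣q∣ ⁅ x ⁆ (span xs))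
  (+-mono-≤ (≤-reflexive (∣⁅x⁆∣≡1 x)) (∣span∣≤ xs))

lookup-⁅⁆ : (x : Fin n) → lookup ⁅ x ⁆ x ≡ true
lookup-⁅⁆ zero    = refl
lookup-⁅⁆ (suc x) = lookup-⁅⁆ x

lookup-span : ∀ {α} (xs : Vec (Fin n) α) (j : Fin α) → lookup (span xs) (lookup xs j) ≡ true
lookup-span (x ∷ xs) zero
  rewrite Vec.lookup-zipWith _∨_ x ⁅ x ⁆ (span xs) | lookup-⁅⁆ x = refl
lookup-span (x ∷ xs) (suc j)
  rewrite Vec.lookup-zipWith _∨_ (lookup xs j) ⁅ x ⁆ (span xs) | lookup-span xs j =
  ∨-zeroʳ (lookup ⁅ x ⁆ (lookup xs j))

miss-or-hit : ∀ {α} (v : Vec Sign n) (xs : Vec (Fin n) α) →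
  ∏ xs (isNull ∘ lookup v) ≡ 1 ⊎ ∃[ j ] lookup v (lookup xs j) ≢ null
miss-or-hit v [] = inj₁ refl
miss-or-hit v (x ∷ xs) with lookup v x in eq
... | pos = inj₂ (zero , λ eq′ → contradiction (trans (sym eq) eq′) λ ())
... | neg = inj₂ (zero , λ eq′ → contradiction (trans (sym eq) eq′) λ ())
... | null with miss-or-hit v xs
...   | inj₁ miss     = inj₁ (trans (+-identityʳ _) miss)
...   | inj₂ (j , v≢) = inj₂ (suc j , v≢)

-- The draws and `R` are kept instead of the query: different samples can give the same query, and
-- counting samples weights each query correctly.
Sample : ℕ → ℕ → Set
Sample n α = Vec (Fin n) α × Subset n

samples : ∀ n α → List (Sample n α)
samples n α = cartesianProductWith _,_ (vectors (allFin n) α) (vectors sides n)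

query : ∀ {α} → Sample n α → Subset n
query (xs , R) = span xs ∩ R

∣query∣≤ : ∀ {α} (q : Sample n α) → ∣ query q ∣ ≤ α
∣query∣≤ (xs , R) = ≤-trans (∣p∩q∣≤∣p∣ (span xs) R) (∣span∣≤ xs)

∑-allFin-1 : ∀ n → ∑ (allFin n) (const 1) ≡ n
∑-allFin-1 n = trans (cong sum (List.map-tabulate {n = n} id (const 1))) (go n)
  where
  go : ∀ n → sum (List.tabulate {n = n} (const 1)) ≡ n
  go zero    = refl
  go (suc n) = cong suc (go n)

∑-samples-1 : ∀ n α → ∑ (samples n α) (const 1) ≡ n ^ α * 2 ^ n
∑-samples-1 n α = begin
  ∑ (samples n α) (const 1)
    ≡⟨ ∑-cartesianProductWith _,_ (vectors (allFin n) α) (vectors sides n) (const 1) ⟩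
  ∑ (vectors (allFin n) α) (λ _ → ∑ (vectors sides n) (const 1))
    ≡⟨ ∑-cong (vectors (allFin n) α) (λ _ → trans (∑-vectors-1 sides n) (sym (+-identityʳ _))) ⟩
  ∑ (vectors (allFin n) α) (λ _ → 1 * 2 ^ n)
    ≡⟨ *-distribʳ-∑ (vectors (allFin n) α) (2 ^ n) (const 1) ⟨
  ∑ (vectors (allFin n) α) (const 1) * 2 ^ n
    ≡⟨ cong (_* 2 ^ n) (trans (∑-vectors-1 (allFin n) α) (cong (_^ α) (∑-allFin-1 n))) ⟩
  n ^ α * 2 ^ n ∎
  where open ≡-Reasoning

-- Condition on the draws: if one of them hits the support, `halving` lets at most half of the
-- `2 ^ n` choices of `R` fail; otherwise all may. By independence, `nulls v ^ α` of the `n ^ α`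
-- tuples of draws miss.
∑-fail≤ : ∀ α (v : Vec Sign n) →
  2 * ∑ (samples n α) (λ q → fail (query q) v) ≤ 2 ^ n * (n ^ α + nulls v ^ α)
∑-fail≤ {n} α v = begin
  2 * ∑ (samples n α) (λ q → fail (query q) v)
    ≡⟨ cong (2 *_) (∑-cartesianProductWith _,_ Xs Rs (λ q → fail (query q) v)) ⟩
  2 * ∑ Xs failures
    ≡⟨ *-distribˡ-∑ Xs 2 failures ⟩
  ∑ Xs (λ xs → 2 * failures xs)
    ≤⟨ ∑-mono Xs bound ⟩
  ∑ Xs (λ xs → 2 ^ n * (1 + ∏ xs (isNull ∘ lookup v)))
    ≡⟨ *-distribˡ-∑ Xs (2 ^ n) _ ⟨
  2 ^ n * ∑ Xs (λ xs → 1 + ∏ xs (isNull ∘ lookup v))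
    ≡⟨ cong (2 ^ n *_) (∑-distrib-+ Xs (const 1) (λ xs → ∏ xs (isNull ∘ lookup v))) ⟩
  2 ^ n * (∑ Xs (const 1) + ∑ Xs (λ xs → ∏ xs (isNull ∘ lookup v)))
    ≡⟨ cong₂ (λ a b → 2 ^ n * (a + b))
         (trans (∑-vectors-1 (allFin n) α) (cong (_^ α) (∑-allFin-1 n)))
         (trans (∑-vectors-∏ (allFin n) (isNull ∘ lookup v) α)
                (cong (_^ α) (∑-allFin-lookup isNull v))) ⟩
  2 ^ n * (n ^ α + nulls v ^ α) ∎
  where
  open ≤-Reasoning
  Xs = vectors (allFin n) α
  Rs = vectors sides n
  failures : Vec (Fin n) α → ℕ
  failures xs = ∑ Rs (λ R → fail (span xs ∩ R) v)
  bound : ∀ xs → 2 * failures xs ≤ 2 ^ n * (1 + ∏ xs (isNull ∘ lookup v))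
  bound xs with miss-or-hit v xs
  ... | inj₂ (j , v≢) = ≤-trans
    (halving (span xs) v (lookup xs j) (lookup-span xs j) v≢ 0 0)
    (m≤m*n (2 ^ n) (1 + ∏ xs (isNull ∘ lookup v)))
  ... | inj₁ miss = begin
    2 * failures xs                                ≤⟨ *-monoʳ-≤ 2 (∑-mono Rs (λ R → δ≤1 (gains (span xs ∩ R) v) (losses (span xs ∩ R) v))) ⟩
    2 * ∑ Rs (const 1)                             ≡⟨ cong (2 *_) (∑-vectors-1 sides n) ⟩
    2 * 2 ^ n                                      ≡⟨ *-comm 2 (2 ^ n) ⟩
    2 ^ n * 2                                      ≡⟨ cong (λ m → 2 ^ n * (1 + m)) miss ⟨
    2 ^ n * (1 + ∏ xs (isNull ∘ lookup v))         ∎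

-- Power inequalities.

^-distribʳ-* : ∀ m n o → (m * n) ^ o ≡ m ^ o * n ^ o
^-distribʳ-* m n zero    = refl
^-distribʳ-* m n (suc o) rewrite ^-distribʳ-* m n o = interchange m n (m ^ o) (n ^ o)
  where
  interchange : ∀ a b c d → a * b * (c * d) ≡ a * c * (b * d)
  interchange = solve-∀

-- Bernoulli's inequality `1 + r * e / h ≤ (1 + e / h) ^ r` with denominators cleared. The induction
-- step drops the term quadratic in `e`.
bernoulli : ∀ h e r → h ^ r * (h + r * e) ≤ (h + e) ^ r * h
bernoulli h e zero    = ≤-reflexive (cong (1 *_) (+-identityʳ h))
bernoulli h e (suc r) = begin
  h * p * (h + (e + r * e))                   ≤⟨ m≤m+n _ (p * (e * (r * e))) ⟩
  h * p * (h + (e + r * e)) + p * (e * (r * e)) ≡⟨ factor h e p (r * e) ⟩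
  (h + e) * (p * (h + r * e))                 ≤⟨ *-monoʳ-≤ (h + e) (bernoulli h e r) ⟩
  (h + e) * ((h + e) ^ r * h)                 ≡⟨ *-assoc (h + e) _ h ⟨
  (h + e) * (h + e) ^ r * h                   ∎
  where
  open ≤-Reasoning
  p = h ^ r
  factor : ∀ h e p x → h * p * (h + (e + x)) + p * (e * x) ≡ (h + e) * (p * (h + x))
  factor = solve-∀

-- (1 − d/n)^α ≤ 1 / (1 + dα/n) with n = c + d and denominators cleared.
reciprocal-bernoulli : ∀ c d α → c ^ α * (c + d + d * α) ≤ (c + d) ^ α * (c + d)
reciprocal-bernoulli c d zero    = ≤-reflexive (cong (1 *_) (trans (cong (c + d +_) (*-zeroʳ d)) (+-identityʳ (c + d))))
reciprocal-bernoulli c d (suc α) = begin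
  c * p * (c + d + d * suc α)   ≤⟨ m≤m+n _ (p * (d * d * suc α)) ⟩
  c * p * (c + d + d * suc α) + p * (d * d * suc α) ≡⟨ factor c d α p ⟩
  (c + d) * (p * (c + d + d * α))         ≤⟨ *-monoʳ-≤ (c + d) (reciprocal-bernoulli c d α) ⟩
  (c + d) * ((c + d) ^ α * (c + d))       ≡⟨ *-assoc (c + d) _ (c + d) ⟨
  (c + d) * (c + d) ^ α * (c + d)         ∎
  where
  open ≤-Reasoning
  p = c ^ α
  factor : ∀ c d α p → c * p * (c + d + d * (1 + α)) + p * (d * d * (1 + α)) ≡
                       (c + d) * (p * (c + d + d * α))
  factor = solve-∀

-- If `f / W ≤ 1 / (1 + e / h)`, then `r ≥ h / e` repetitions halve it, since Bernoulli gives
-- `(1 + e / h) ^ r ≥ 2`.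
halve-power : ∀ f W h e r .{{_ : NonZero h}} →
  f * (h + e) ≤ W * h → h ≤ r * e → f ^ r * 2 ≤ W ^ r
halve-power f W h e r f≤ h≤ = *-cancelʳ-≤ _ _ (h ^ r) {{m^n≢0 h r}} (begin
  f ^ r * 2 * h ^ r   ≡⟨ *-assoc (f ^ r) 2 (h ^ r) ⟩
  f ^ r * (2 * h ^ r) ≤⟨ *-monoʳ-≤ (f ^ r) double ⟩
  f ^ r * (h + e) ^ r ≡⟨ ^-distribʳ-* f (h + e) r ⟨
  (f * (h + e)) ^ r   ≤⟨ ^-monoˡ-≤ r f≤ ⟩
  (W * h) ^ r         ≡⟨ ^-distribʳ-* W h r ⟩
  W ^ r * h ^ r       ∎)
  where
  open ≤-Reasoning
  rearrange : ∀ h p → 2 * p * h ≡ p * (h + h)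
  rearrange = solve-∀
  double : 2 * h ^ r ≤ (h + e) ^ r
  double = *-cancelʳ-≤ _ _ h (begin
    2 * h ^ r * h       ≡⟨ rearrange h (h ^ r) ⟩
    h ^ r * (h + h)     ≤⟨ *-monoʳ-≤ (h ^ r) (+-monoʳ-≤ h h≤) ⟩
    h ^ r * (h + r * e) ≤⟨ bernoulli h e r ⟩
    (h + e) ^ r * h     ∎)

-- The `T` trials contain `d` blocks of length `r`, each worth a factor 1/2; the `u` left over do no
-- harm because `f ≤ W`. Raising to the power `s` turns `2 ^ d` into `(2 ^ s) ^ d`.
power-decay : ∀ f W r d s {T} → f ≤ W → f ^ r * 2 ≤ W ^ r → r * d ≤ T →
              f ^ (T * s) * (2 ^ s) ^ d ≤ W ^ (T * s)
power-decay f W r d s {T} f≤W half r*d≤T with u , refl ← m≤n⇒∃[o]m+o≡n r*d≤T = begin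
  f ^ (T * s) * (2 ^ s) ^ d    ≡⟨ cong₂ _*_ (sym (^-*-assoc f T s)) (^-swap 2 s d) ⟩
  (f ^ T) ^ s * (2 ^ d) ^ s    ≡⟨ ^-distribʳ-* (f ^ T) (2 ^ d) s ⟨
  (f ^ T * 2 ^ d) ^ s          ≤⟨ ^-monoˡ-≤ s (begin
    f ^ T * 2 ^ d                ≡⟨ cong (_* 2 ^ d) (^-distribˡ-+-* f (r * d) u) ⟩
    f ^ (r * d) * f ^ u * 2 ^ d  ≡⟨ cong (λ x → x * f ^ u * 2 ^ d) (^-*-assoc f r d) ⟨
    (f ^ r) ^ d * f ^ u * 2 ^ d  ≡⟨ swap ((f ^ r) ^ d) (f ^ u) (2 ^ d) ⟩
    (f ^ r) ^ d * 2 ^ d * f ^ u  ≡⟨ cong (_* f ^ u) (^-distribʳ-* (f ^ r) 2 d) ⟨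
    (f ^ r * 2) ^ d * f ^ u      ≤⟨ *-mono-≤ (^-monoˡ-≤ d half) (^-monoˡ-≤ u f≤W) ⟩
    (W ^ r) ^ d * W ^ u          ≡⟨ cong (_* W ^ u) (^-*-assoc W r d) ⟩
    W ^ (r * d) * W ^ u          ≡⟨ ^-distribˡ-+-* W (r * d) u ⟨
    W ^ T                        ∎) ⟩
  (W ^ T) ^ s                  ≡⟨ ^-*-assoc W T s ⟩
  W ^ (T * s)                  ∎
  where
  open ≤-Reasoning
  ^-swap : ∀ m n o → (m ^ n) ^ o ≡ (m ^ o) ^ n
  ^-swap m n o = trans (^-*-assoc m n o) (trans (cong (m ^_) (*-comm n o)) (sym (^-*-assoc m o n)))
  swap : ∀ a b c → a * b * c ≡ a * c * b
  swap = solve-∀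

-- Failure of a whole sequence on one sign vector.

rounds : (n k α : ℕ) .{{_ : NonZero α}} → ℕ
rounds n k α = (2 * n) / α + 4 * k

module _ (k α : ℕ) .{{α≢0 : NonZero α}} (v : Vec Sign n)
         (0<d : 0 < support v) (d≤2k : support v ≤ 2 * k) where

  private
    c = nulls v
    d = support v
    e = d * α
    h = 2 * n + e
    F = ∑ (samples n α) (λ q → fail (query q) v)
    W = n ^ α * 2 ^ n
    T = rounds n k α

    instance
      e≢0 : NonZero e
      e≢0 = m*n≢0 d α {{>-nonZero 0<d}}
      h≢0 : NonZero h
      h≢0 = >-nonZero (<-≤-trans (>-nonZero⁻¹ e) (m≤n+m e (2 * n)))

    r : ℕ
    -- One more than the floor exceeds the exact quotient, so `r` tests are enough for halving.
    r = suc (h / e)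

    open ≤-Reasoning

    -- By `∑-fail≤` the rate is at most half of `1 + (c / n) ^ α`, hence half of `1 + n / (n + e)`.
    -- That is `h / (h + e)`, which explains the choice of `h`.
    failure-rate : F * (h + e) ≤ W * h
    failure-rate = begin
      F * (h + e)                                   ≡⟨ double F n e ⟩
      2 * F * (n + e)                               ≤⟨ *-monoˡ-≤ (n + e) (∑-fail≤ α v) ⟩
      2 ^ n * (n ^ α + c ^ α) * (n + e)             ≡⟨ expand (2 ^ n) (n ^ α) (c ^ α) (n + e) ⟩
      2 ^ n * (n ^ α * (n + e) + c ^ α * (n + e))   ≤⟨ *-monoʳ-≤ (2 ^ n) (+-monoʳ-≤ (n ^ α * (n + e)) miss≤) ⟩
      2 ^ n * (n ^ α * (n + e) + n ^ α * n)         ≡⟨ collect (2 ^ n) (n ^ α) n e ⟩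
      W * h                                         ∎
      where
      double : ∀ f n e → f * (2 * n + e + e) ≡ 2 * f * (n + e)
      double = solve-∀
      expand : ∀ p a b x → p * (a + b) * x ≡ p * (a * x + b * x)
      expand = solve-∀
      collect : ∀ p a n e → p * (a * (n + e) + a * n) ≡ a * p * (2 * n + e)
      collect = solve-∀
      miss≤ : c ^ α * (n + e) ≤ n ^ α * n
      miss≤ = subst (λ m → c ^ α * (m + e) ≤ m ^ α * m) (nulls+support v) (reciprocal-bernoulli c d α)

    F≤W : F ≤ W
    F≤W = *-cancelʳ-≤ F W h (≤-trans (*-monoʳ-≤ F (m≤m+n h e)) failure-rate)

    h≤r*e : h ≤ r * e
    h≤r*e = begin
      h                   ≡⟨ m≡m%n+[m/n]*n h e ⟩
      h % e + h / e * e ≤⟨ +-monoˡ-≤ (h / e * e) (<⇒≤ (m%n<n h e)) ⟩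
      e + h / e * e       ∎

    -- Since `e = d * α`, the product is at most `d + h / α`, and `h = 2 * n + d * α` makes this
    -- `2 * n / α + 2 * d`. Bounding `d` by `2 * k` gives the `4 * k` in `rounds` and one length for
    -- all `v`.
    r*d≤T : r * d ≤ T
    r*d≤T = begin
      d + h / e * d               ≡⟨ cong (d +_) (m*n/n≡m (h / e * d) α) ⟨
      d + (h / e * d * α) / α     ≤⟨ +-monoʳ-≤ d (/-monoˡ-≤ α
                                       (≤-trans (≤-reflexive (*-assoc (h / e) d α)) (m/n*n≤m h e))) ⟩
      d + h / α                   ≡⟨ cong (d +_) (+-distrib-/-∣ʳ (2 * n) (n∣m*n d)) ⟩
      d + ((2 * n) / α + d * α / α) ≡⟨ cong (λ x → d + ((2 * n) / α + x)) (m*n/n≡m d α) ⟩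
      d + ((2 * n) / α + d)       ≡⟨ rotate d ((2 * n) / α) ⟩
      (2 * n) / α + (d + d)       ≤⟨ +-monoʳ-≤ ((2 * n) / α) (+-mono-≤ d≤2k d≤2k) ⟩
      (2 * n) / α + (2 * k + 2 * k) ≡⟨ cong ((2 * n) / α +_) (four k) ⟩
      T                           ∎
      where
      rotate : ∀ d q → d + (q + d) ≡ q + (d + d)
      rotate = solve-∀
      four : ∀ k → 2 * k + 2 * k ≡ 4 * k
      four = solve-∀

  failures-decay : ∀ s → F ^ (T * s) * (2 ^ s) ^ d ≤ W ^ (T * s)
  failures-decay s = power-decay F W r d s F≤W (halve-power F W h e r failure-rate h≤r*e) r*d≤T

-- Union bound over sign vectors.

-- A converse to Bernoulli, `(1 + 2 / m) ^ n ≤ 1 + 4 * n / m`. Doubling the linear term pays for the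
-- higher ones: each step leaves an excess of `8 * n`, which is at most `2 * m`.
power-growth : ∀ m n → 4 * n ≤ m → (m + 2) ^ n * m ≤ m ^ n * (m + 4 * n)
power-growth m zero    _  = ≤-reflexive (cong (1 *_) (sym (+-identityʳ m)))
power-growth m (suc n) 4n≤m = begin
  (m + 2) * (m + 2) ^ n * m         ≡⟨ *-assoc (m + 2) _ m ⟩
  (m + 2) * ((m + 2) ^ n * m)       ≤⟨ *-monoʳ-≤ (m + 2) (power-growth m n 4n≤m′) ⟩
  (m + 2) * (m ^ n * (m + 4 * n))   ≡⟨ expand m n (m ^ n) ⟩
  m ^ n * (m * (m + 4 * n + 2) + 2 * (4 * n)) ≤⟨ *-monoʳ-≤ (m ^ n) (+-monoʳ-≤ (m * (m + 4 * n + 2)) (*-monoʳ-≤ 2 4n≤m′)) ⟩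
  m ^ n * (m * (m + 4 * n + 2) + 2 * m) ≡⟨ collect m n (m ^ n) ⟩
  m * m ^ n * (m + 4 * suc n)       ∎
  where
  open ≤-Reasoning
  4n≤m′ = ≤-trans (*-monoʳ-≤ 4 (n≤1+n n)) 4n≤m
  expand : ∀ m n p → (m + 2) * (p * (m + 4 * n)) ≡ p * (m * (m + 4 * n + 2) + 2 * (4 * n))
  expand = solve-∀
  collect : ∀ m n p → p * (m * (m + 4 * n + 2) + 2 * m) ≡ m * p * (m + 4 * (1 + n))
  collect = solve-∀

-- Here `(1 + 2 / m) ^ n` is the sum of `(1 / m) ^ support v` over all sign vectors `v`. The null
-- vector gives 1, so the others total less than 1.
[m+2]^n<2*m^n : ∀ m n → 4 * n < m → (m + 2) ^ n < 2 * m ^ n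
[m+2]^n<2*m^n m n 4n<m = *-cancelʳ-< m _ _ (begin-strict
  (m + 2) ^ n * m     ≤⟨ power-growth m n (<⇒≤ 4n<m) ⟩
  m ^ n * (m + 4 * n) <⟨ *-monoʳ-< (m ^ n) {{m^n≢0 m n}} (+-monoʳ-< m 4n<m) ⟩
  m ^ n * (m + m)     ≡⟨ rearrange m (m ^ n) ⟩
  2 * m ^ n * m       ∎)
  where
  open ≤-Reasoning
  instance
    m≢0 : NonZero m
    m≢0 = >-nonZero (≤-<-trans z≤n 4n<m)
  rearrange : ∀ m p → p * (m + m) ≡ 2 * p * m
  rearrange = solve-∀

∏-isNull : (v : Vec Sign n) → ∏ v isNull ≡ δ 0 (support v)
∏-isNull []         = refl
∏-isNull (null ∷ v) = trans (+-identityʳ _) (∏-isNull v)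
∏-isNull (pos ∷ v)  = refl
∏-isNull (neg ∷ v)  = refl

-- `∏ v (slack m)` is `m` to the power `n` minus the support, free of truncated subtraction and
-- summable by `∑-vectors-∏`.
slack : ℕ → Sign → ℕ
slack m null = m
slack m _    = 1

∏-slack : ∀ m (v : Vec Sign n) → m ^ support v * ∏ v (slack m) ≡ m ^ n
∏-slack m []         = refl
∏-slack m (null ∷ v) = trans (swap m (m ^ support v) _) (cong (m *_) (∏-slack m v))
  where
  swap : ∀ a b c → b * (a * c) ≡ a * (b * c)
  swap = solve-∀
∏-slack m (pos ∷ v)  = trans (*-assoc m _ _) (cong (m *_) (trans (cong (m ^ support v *_) (+-identityʳ _)) (∏-slack m v)))
∏-slack m (neg ∷ v)  = trans (*-assoc m _ _) (cong (m *_) (trans (cong (m ^ support v *_) (+-identityʳ _)) (∏-slack m v)))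

-- With `m = 2 * k` this admits the supports that two different sets of size at most `k` can
-- produce. As a 0-1 weight it can start `selection`.
window : ℕ → ℕ → ℕ
window m d with 0 <? d | d ≤? m
... | yes _ | yes _ = 1
... | _     | _     = 0

window≡1 : ∀ m d → 0 < d → d ≤ m → window m d ≡ 1
window≡1 m d 0<d d≤m with 0 <? d | d ≤? m
... | yes _  | yes _  = refl
... | no d≯0 | _      = contradiction 0<d d≯0
... | yes _  | no d≰m = contradiction d≤m d≰m

-- Multiplied by m ^ n, the union bound becomes a part of W times
-- ∑ᵥ m ^ (n ∸ d) = (m + 2) ^ n, whose null vector contributes W * m ^ n.
expected-failures : ∀ (f : Vec Sign n → ℕ) b W m → 4 * n < m → .{{NonZero W}} →
  (∀ v → 0 < support v → support v ≤ b → f v * m ^ support v ≤ W) →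
  ∑ (vectors signs n) (λ v → window b (support v) * f v) < W
expected-failures {n} f b W m 4n<m f≤ = *-cancelʳ-< (m ^ n) _ _ (+-cancelʳ-< (W * m ^ n) _ _ (begin-strict
  ∑ V g * m ^ n + W * m ^ n
    ≡⟨ cong₂ _+_ (*-distribʳ-∑ V (m ^ n) g) (sym null-term) ⟩
  ∑ V (λ v → g v * m ^ n) + ∑ V (λ v → ∏ v isNull * (W * m ^ n))
    ≡⟨ ∑-distrib-+ V _ _ ⟨
  ∑ V (λ v → g v * m ^ n + ∏ v isNull * (W * m ^ n))
    ≤⟨ ∑-mono V termwise ⟩
  ∑ V (λ v → W * ∏ v (slack m))
    ≡⟨ *-distribˡ-∑ V W _ ⟨
  W * ∑ V (λ v → ∏ v (slack m))
    ≡⟨ cong (W *_) (trans (∑-vectors-∏ signs (slack m) n) (cong (_^ n) (three m))) ⟩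
  W * (m + 2) ^ n
    <⟨ *-monoʳ-< W ([m+2]^n<2*m^n m n 4n<m) ⟩
  W * (2 * m ^ n)
    ≡⟨ double W (m ^ n) ⟩
  W * m ^ n + W * m ^ n ∎))
  where
  open ≤-Reasoning
  V = vectors signs n
  g : Vec Sign n → ℕ
  g v = window b (support v) * f v
  three : ∀ m → 1 + (m + 1) ≡ m + 2
  three = solve-∀
  double : ∀ w p → w * (2 * p) ≡ w * p + w * p
  double = solve-∀
  null-term : ∑ V (λ v → ∏ v isNull * (W * m ^ n)) ≡ W * m ^ n
  null-term = trans (sym (*-distribʳ-∑ V (W * m ^ n) (λ v → ∏ v isNull)))
    (trans (cong (_* (W * m ^ n)) (trans (∑-vectors-∏ signs isNull n) (^-zeroˡ n))) (*-identityˡ _))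
  termwise : ∀ v → g v * m ^ n + ∏ v isNull * (W * m ^ n) ≤ W * ∏ v (slack m)
  termwise v rewrite ∏-isNull v with ∏-slack m v | f≤ v
  ... | slack≡ | fv≤ with support v
  -- The null vector has window weight 0, so its whole term is the indicator part added on the left.
  ...   | zero  = ≤-reflexive (trans (*-identityˡ (W * m ^ n)) (cong (W *_) (sym (trans (sym (*-identityˡ _)) slack≡))))
  ...   | suc d with suc d ≤? b
  ...     | no _    = z≤n
  ...     | yes d≤b = begin
    1 * f v * m ^ n + 0                 ≡⟨ tidy (f v) (m ^ n) ⟩
    f v * m ^ n                         ≡⟨ cong (f v *_) slack≡ ⟨
    f v * (m ^ suc d * ∏ v (slack m))   ≡⟨ *-assoc (f v) (m ^ suc d) _ ⟨
    f v * m ^ suc d * ∏ v (slack m)     ≤⟨ *-monoˡ-≤ (∏ v (slack m)) (fv≤ (s≤s z≤n) d≤b) ⟩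
    W * ∏ v (slack m)                   ∎
    where
    tidy : ∀ x y → 1 * x * y + 0 ≡ x * y
    tidy = solve-∀

-- From equal feedback to failing queries.

feedback≡⇒fail≡1 : ∀ {α} (Q K₁ K₂ : Subset n) → ∣ Q ∣ ≤ α →
  cappedFeedback α (Q ∩ K₁) ≡ cappedFeedback α (Q ∩ K₂) → fail Q (difference K₁ K₂) ≡ 1
feedback≡⇒fail≡1 {α = α} Q K₁ K₂ ∣Q∣≤α eq =
  trans (cong (λ l → δ (gains Q v) l) losses≡gains) (δ-refl (gains Q v))
  where
  v = difference K₁ K₂
  uncapped : ∀ K → cappedFeedback α (Q ∩ K) ≡ ∣ Q ∩ K ∣
  uncapped K = m≤n⇒m⊓n≡m (≤-trans (∣p∩q∣≤∣p∣ Q K) ∣Q∣≤α)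
  losses≡gains : losses Q v ≡ gains Q v
  losses≡gains = +-cancelˡ-≡ ∣ Q ∩ K₂ ∣ _ _ (trans
    (cong (_+ losses Q v) (sym (trans (sym (uncapped K₁)) (trans eq (uncapped K₂)))))
    (difference-balance Q K₁ K₂))

feedbackVector≡⇒∏-fail≡1 : ∀ {α t} (qs : Vec (Sample n α) t) (K₁ K₂ : Subset n) →
  feedbackVector α (Vec.map query qs) K₁ ≡ feedbackVector α (Vec.map query qs) K₂ →
  ∏ qs (λ q → fail (query q) (difference K₁ K₂)) ≡ 1
feedbackVector≡⇒∏-fail≡1 []       K₁ K₂ eq = refl
feedbackVector≡⇒∏-fail≡1 (q ∷ qs) K₁ K₂ eq = cong₂ _*_
  (feedback≡⇒fail≡1 (query q) K₁ K₂ (∣query∣≤ q) (Vec.∷-injectiveˡ eq))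
  (feedbackVector≡⇒∏-fail≡1 qs K₁ K₂ (Vec.∷-injectiveʳ eq))

-- The total returned by `selection` is a natural number below 1, so every term is 0. Two different
-- sets with equal feedback would give a term 1: their sign vector has support between 1 and
-- `2 * k`, hence weight 1, and every query fails on it.
sampled-solution : ∀ n k α .{{_ : NonZero n}} .{{_ : NonZero α}} s → 4 * n < 2 ^ s →
  Σ[ Qs ∈ Vec (Subset n) (rounds n k α * s) ] SolvesGroupTesting k α Qs
sampled-solution n k α s 4n<2^s =
  let qs , <1 = selection Ω V (λ q v → fail (query q) v) t w expected in
  Vec.map query qs , λ K₁ K₂ K₁≤k K₂≤k K₁≢K₂ eq →
    let v = difference K₁ K₂
        w≡1 = window≡1 (2 * k) (support v)
                (n≢0⇒n>0 (K₁≢K₂ ∘ support-difference≡0 K₁ K₂))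
                (≤-trans (support-difference≤ K₁ K₂)
                  (+-mono-≤ K₁≤k (≤-trans K₂≤k (≤-reflexive (sym (+-identityʳ k))))))
        ≡0 = ∑≡0⇒≡0 (λ v → w v * ∏ qs (λ q → fail (query q) v)) (n<1⇒n≡0 <1) (∈-vectors ∈-signs v)
    in 1+n≢0 (trans (sym (cong₂ _*_ w≡1 (feedbackVector≡⇒∏-fail≡1 qs K₁ K₂ eq))) ≡0)
  where
  t = rounds n k α * s
  Ω = samples n α
  V = vectors signs n
  w : Vec Sign n → ℕ
  w v = window (2 * k) (support v)
  W = n ^ α * 2 ^ n
  expected : ∑ V (λ v → w v * ∑ Ω (λ q → fail (query q) v) ^ t) < ∑ Ω (const 1) ^ t
  expected rewrite ∑-samples-1 n α =
    expected-failures (λ v → ∑ Ω (λ q → fail (query q) v) ^ t) (2 * k) (W ^ t) (2 ^ s) 4n<2^s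
      {{m^n≢0 W t {{m*n≢0 (n ^ α) (2 ^ n) {{m^n≢0 n α}} {{m^n≢0 2 n}}}}}}
      (λ v 0<d d≤2k → failures-decay k α v 0<d d≤2k s)

-- Singleton queries.

bit : Bool → ℕ
bit true  = 1
bit false = 0

bit-injective : ∀ {b c} → bit b ≡ bit c → b ≡ c
bit-injective {true}  {true}  _ = refl
bit-injective {false} {false} _ = refl

∣⁅i⁆∩p∣ : (i : Fin n) (p : Subset n) → ∣ ⁅ i ⁆ ∩ p ∣ ≡ bit (lookup p i)
∣⁅i⁆∩p∣ {suc n} zero    (true ∷ p)  = cong suc (trans (cong ∣_∣ (∩-zeroˡ p)) (∣⊥∣≡0 n))
∣⁅i⁆∩p∣ {suc n} zero    (false ∷ p) = trans (cong ∣_∣ (∩-zeroˡ p)) (∣⊥∣≡0 n)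
∣⁅i⁆∩p∣ (suc i) (x ∷ p) = ∣⁅i⁆∩p∣ i p

bit⊓ : ∀ b α .{{_ : NonZero α}} → bit b ⊓ α ≡ bit b
bit⊓ true  (suc α) = refl
bit⊓ false (suc α) = refl

-- Each singleton reveals one membership bit, which the cap preserves because `α ≥ 1`.
singletons-solve : ∀ n k α .{{_ : NonZero α}} → SolvesGroupTesting k α (Vec.tabulate {n = n} ⁅_⁆)
singletons-solve n k α K₁ K₂ _ _ K₁≢K₂ eq = K₁≢K₂ (begin
  K₁                        ≡⟨ Vec.tabulate∘lookup K₁ ⟨
  Vec.tabulate (lookup K₁)  ≡⟨ Vec.tabulate-cong pointwise ⟩
  Vec.tabulate (lookup K₂)  ≡⟨ Vec.tabulate∘lookup K₂ ⟩
  K₂                        ∎)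
  where
  open ≡-Reasoning
  entry : ∀ K i → lookup (feedbackVector α (Vec.tabulate ⁅_⁆) K) i ≡ bit (lookup K i)
  entry K i = begin
    lookup (feedbackVector α (Vec.tabulate ⁅_⁆) K) i  ≡⟨ Vec.lookup-map i _ (Vec.tabulate ⁅_⁆) ⟩
    cappedFeedback α (lookup (Vec.tabulate ⁅_⁆) i ∩ K) ≡⟨ cong (λ Q → cappedFeedback α (Q ∩ K)) (Vec.lookup∘tabulate ⁅_⁆ i) ⟩
    cappedFeedback α (⁅ i ⁆ ∩ K)                      ≡⟨ cong (_⊓ α) (∣⁅i⁆∩p∣ i K) ⟩
    bit (lookup K i) ⊓ α                              ≡⟨ bit⊓ (lookup K i) α ⟩
    bit (lookup K i)                                  ∎
  pointwise : ∀ i → lookup K₁ i ≡ lookup K₂ i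
  pointwise i = bit-injective (trans (sym (entry K₁ i)) (trans (cong (λ u → lookup u i) eq) (entry K₂ i)))

-- The length bound and its constant.

n<2^[1+⌊log₂n⌋] : ∀ n → n < 2 ^ suc ⌊log₂ n ⌋
n<2^[1+⌊log₂n⌋] n = ≰⇒> λ 2^≤n → 1+n≰n (≤-trans
  (≤-reflexive (sym (⌊log₂[2^n]⌋≡n (suc ⌊log₂ n ⌋)))) (⌊log₂⌋-mono-≤ 2^≤n))

fromℕ-≤-* : ∀ c n → .{{NonZero c}} → fromℕ n ℚᵘ.≤ fromℕ c ℚᵘ.* fromℕ n
fromℕ-≤-* c n = ℚᵘ.*≤* (subst₂ ℤ._≤_
  (sym (ℤ.*-identityʳ (ℤ.+ n)))
  (sym (trans (ℤ.*-identityʳ _) (sym (ℤ.pos-* c n))))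
  (ℤ.+≤+ (m≤n*m n c)))

-- Multiplying by `α` clears the only real denominator, which unnormalised arithmetic presents as
-- `1 * (1 * α * 1)`.
fromℕ-≤-bound : ∀ c t n k α l .{{_ : NonZero α}} → t * α ≤ c * ((k * α + n) * l) →
  fromℕ t ℚᵘ.≤ fromℕ c ℚᵘ.* ((fromℕ k ℚᵘ.+ (ℤ.+ n ℚᵘ./ α)) ℚᵘ.* fromℕ l)
fromℕ-≤-bound c t n k α@(suc _) l t*α≤ = ℚᵘ.*≤* (subst₂ ℤ._≤_
  (trans (ℤ.pos-* t α) (cong (λ d → ℤ.+ t ℤ.* ℤ.+ d) (sym denominator)))
  (sym (trans (ℤ.*-identityʳ _) numerator))
  (ℤ.+≤+ t*α≤))
  where
  denominator : 1 * (1 * α * 1) ≡ α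
  denominator = trans (*-identityˡ _) (trans (*-identityʳ _) (*-identityˡ α))
  numerator : ℤ.+ c ℤ.* ((ℤ.+ k ℤ.* ℤ.+ α ℤ.+ ℤ.+ n ℤ.* ℤ.+ 1) ℤ.* ℤ.+ l) ≡ ℤ.+ (c * ((k * α + n) * l))
  numerator
    rewrite ℤ.*-identityʳ (ℤ.+ n) | sym (ℤ.pos-* k α) | sym (ℤ.pos-* (k * α + n) l)
          | sym (ℤ.pos-* c ((k * α + n) * l)) = refl

rounds*α≤ : ∀ n k α .{{_ : NonZero α}} → rounds n k α * α ≤ 4 * (k * α + n)
rounds*α≤ n k α = begin
  ((2 * n) / α + 4 * k) * α     ≡⟨ *-distribʳ-+ α ((2 * n) / α) (4 * k) ⟩
  (2 * n) / α * α + 4 * k * α   ≤⟨ +-monoˡ-≤ (4 * k * α) (m/n*n≤m (2 * n) α) ⟩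
  2 * n + 4 * k * α             ≤⟨ m≤m+n _ (2 * n) ⟩
  2 * n + 4 * k * α + 2 * n     ≡⟨ collect n k α ⟩
  4 * (k * α + n)               ∎
  where
  open ≤-Reasoning
  collect : ∀ n k α → 2 * n + 4 * k * α + 2 * n ≡ 4 * (k * α + n)
  collect = solve-∀

theorem3 : Σ[ C ∈ ℕ ] ((n k α : ℕ) .{{_ : NonZero α}} → 2 ≤ n → α ≤ k → k ≤ n →
    Σ[ t ∈ ℕ ] Σ[ Qs ∈ Vec (Subset n) t ]
    ((fromℕ t ℚᵘ.≤ fromℕ C ℚᵘ.* queryBound n k α) × SolvesGroupTesting k α Qs))
-- One factor 4 comes from `rounds*α≤`, the other from `s ≤ 4 * L`.
theorem3 = 16 , construction
  where
  construction : (n k α : ℕ) .{{_ : NonZero α}} → 2 ≤ n → α ≤ k → k ≤ n →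
    Σ[ t ∈ ℕ ] Σ[ Qs ∈ Vec (Subset n) t ]
    ((fromℕ t ℚᵘ.≤ fromℕ 16 ℚᵘ.* queryBound n k α) × SolvesGroupTesting k α Qs)
  construction n k α 2≤n _ _
    with ℚᵘ.⊓-sel (fromℕ n) ((fromℕ k ℚᵘ.+ (ℤ.+ n ℚᵘ./ α)) ℚᵘ.* fromℕ ⌊log₂ n ⌋)
  ... | inj₁ min≃ =
    n , Vec.tabulate ⁅_⁆ ,
    ℚᵘ.≤-trans (fromℕ-≤-* 16 n) (ℚᵘ.≤-reflexive (ℚᵘ.*-congˡ {fromℕ 16} (ℚᵘ.≃-sym min≃))) ,
    singletons-solve n k α
  ... | inj₂ min≃ =
    let Qs , solves = sampled-solution n k α {{>-nonZero (<-trans (s≤s z≤n) 2≤n)}} s 4n<2^s in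
    rounds n k α * s , Qs ,
    ℚᵘ.≤-trans (fromℕ-≤-bound 16 (rounds n k α * s) n k α L length≤)
      (ℚᵘ.≤-reflexive (ℚᵘ.*-congˡ {fromℕ 16} (ℚᵘ.≃-sym min≃))) ,
    solves
    where
    open ≤-Reasoning
    L = ⌊log₂ n ⌋
    -- Since `n < 2 ^ (1 + L)`, two further doublings make `2 ^ s` exceed `4 * n`.
    s = 3 + L
    -- From `n ≥ 2` the logarithm is at least 1, so the 3 in `s` is absorbed into `3 * L`.
    1≤L : 1 ≤ L
    1≤L = subst (_≤ L) (⌊log₂[2^n]⌋≡n 1) (⌊log₂⌋-mono-≤ 2≤n)
    4n<2^s : 4 * n < 2 ^ s
    4n<2^s = <-≤-trans (*-monoʳ-< 4 (n<2^[1+⌊log₂n⌋] n)) (≤-reflexive (*-assoc 2 2 (2 ^ suc L)))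
    s≤4L : s ≤ 4 * L
    s≤4L = ≤-trans (+-monoˡ-≤ L (*-monoʳ-≤ 3 1≤L)) (≤-reflexive (+-comm (3 * L) L))
    length≤ : rounds n k α * s * α ≤ 16 * ((k * α + n) * L)
    length≤ = begin
      rounds n k α * s * α             ≡⟨ swap (rounds n k α) s α ⟩
      rounds n k α * α * s             ≤⟨ *-mono-≤ (rounds*α≤ n k α) s≤4L ⟩
      4 * (k * α + n) * (4 * L)        ≡⟨ collect (k * α + n) L ⟩
      16 * ((k * α + n) * L)           ∎
      where
      swap : ∀ a b c → a * b * c ≡ a * c * b
      swap = solve-∀
      collect : ∀ x l → 4 * x * (4 * l) ≡ 16 * (x * l)
      collect = solve-∀
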